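{- Let $r$ and $s$ be positive integers with $r\geq 2s-2$, and let $G$ be a graph of order $n=3r+4s$ with $\sigma_2(G)\geq n+r$. Then $G$ contains $r$ triangles and $s$ quadrilaterals ($4$-cycles), all pairwise vertex-disjoint.
   Context: All graphs are finite, simple and undirected. $\sigma_2(G)=\min\{d(x)+d(y): x,y\in V(G),\ x\neq y,\ xy\notin E(G)\}$, where $d(x)$ is the degree of $x$; if $G$ is complete, $\sigma_2(G)=\infty$. -}

module Defs where

open import Data.Nat using (ℕ; _+_; _*_; _≤_)
open import Data.Bool using (Bool; true; false)
open import Data.Fin using (Fin)
open import Data.Product using (_×_; Σ; ∃-syntax)
open import Data.Sum using (_⊎_)
open import Data.Vec using (count; allFin)
open import Relation.Binary.PropositionalEquality using (_≡_; _≢_)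
open import Relation.Nullary using (¬_)
open import Function.Definitions using (Injective)

record Graph (n : ℕ) : Set where
  field
    adj       : Fin n → Fin n → Bool
    symmetric : ∀ x y → adj x y ≡ adj y x
    irreflex  : ∀ x → adj x x ≡ false

open Graph public

Adj : ∀ {n} → Graph n → Fin n → Fin n → Set
Adj G x y = adj G x y ≡ true

degree : ∀ {n} → Graph n → Fin n → ℕ
degree G x = count (λ y → Data.Bool._≟_ (adj G x y) true) (allFin _)

-- σ₂(G) ≥ k  (σ₂ = ∞ for complete graphs, so then it holds vacuously)
σ₂≥ : ∀ {n} → Graph n → ℕ → Set
σ₂≥ {n} G k = ∀ (x y : Fin n) → x ≢ y → ¬ Adj G x y → k ≤ degree G x + degree G y

HasDisjointTrianglesQuads : ∀ {n} → Graph n → ℕ → ℕ → Set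
HasDisjointTrianglesQuads {n} G r s =
  Σ (Fin r → Fin 3 → Fin n) λ T →
  Σ (Fin s → Fin 4 → Fin n) λ Q →
    Injective _≡_ _≡_ (vertexOf T Q)
    × (∀ i → Adj G (T i 0F) (T i 1F) × Adj G (T i 1F) (T i 2F) × Adj G (T i 2F) (T i 0F))
    × (∀ j → Adj G (Q j 0F) (Q j 1F) × Adj G (Q j 1F) (Q j 2F)
           × Adj G (Q j 2F) (Q j 3F) × Adj G (Q j 3F) (Q j 0F))
  where
  open import Data.Fin.Patterns using (0F; 1F; 2F; 3F)
  vertexOf : (Fin r → Fin 3 → Fin n) → (Fin s → Fin 4 → Fin n)
           → (Fin r × Fin 3) ⊎ (Fin s × Fin 4) → Fin n
  vertexOf T Q (Data.Sum.inj₁ (i Data.Product., a)) = T i a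
  vertexOf T Q (Data.Sum.inj₂ (j Data.Product., b)) = Q j b

{-# OPTIONS --safe #-}
module Submission where

-- Start from the complete graph on the vertices of G, which has the required cycles, and delete the
-- edges outside G one at a time.  Deleting an edge spoils at most one cycle, so it suffices to repair
-- a packing in which one triangle is replaced by a path x z y, or one quadrilateral by a path x u v y.
-- In each case a combination of Ore inequalities for nonadjacent vertices of the spoiled part shows
-- that some cycle C of the packing sends many edges to that part, and a finite check of the graphs on
-- these few vertices gives an exchange.
--   * Path x u v y: weights 1,1,1,1.  The exchange closes the quadrilateral or leaves a paw.
--   * Paw (triangle x u v, pendant edge v y): weights 1,1,0,2; triangles can be exchanged from load 7
--     on, quadrilaterals only from 13 on, and 6r + 12(s-1) <= 8(r+s-1) is where r >= 2s-2 is needed.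
--   * Path x z y: if C is a quadrilateral, the exchange yields a triangle and a path on four vertices.
--     If C is a triangle a b c, then (up to symmetry) x is adjacent to a, b, c and y to a, b, so
--     z x c could equally be the spoiled part with y a b as triangle; the pairs x y and z c, the
--     latter counted twice, then force an exchange with a further cycle.

open import Defs
open import Data.Nat using (ℕ; zero; suc; _+_; _*_; _∸_; _≤_; _<_; z≤n; _≡ᵇ_; _<ᵇ_; _≤?_; _<?_)
open import Data.Nat.DivMod using (_/_; _%_)
open import Data.Nat.ListAction using (sum)
open import Data.Nat.ListAction.Properties using (sum-++; sum-↭)
open import Data.Nat.Properties
  using (≡ᵇ⇒≡; <ᵇ⇒<; ≤-refl; ≤-reflexive; ≤-trans; <-≤-trans; ≰⇒>; ≮⇒≥; n≮n; n≤1+n; ≤-pred;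
         +-mono-≤; +-monoʳ-≤; *-monoʳ-≤; *-identityʳ; *-zeroʳ; *-suc; m≤n+o⇒m∸n≤o; m≤n+m∸n;
         m≤n⇒m≤1+n; +-cancelˡ-≤; suc-injective; module ≤-Reasoning)
open import Data.Nat.Tactic.RingSolver using (solve-∀)
open import Data.Bool using (Bool; true; false; _∧_; _∨_; not; if_then_else_)
open import Data.Bool.ListAction using (any; all)
open import Data.Bool.Properties using (T?; T-≡; ∨-comm; ∧-comm)
open import Data.Fin using (Fin; zero; suc)
open import Data.Fin.Patterns using (0F; 1F; 2F; 3F)
open import Data.Fin.Properties using () renaming (_≟_ to _≟ᶠ_)
open import Data.List
  using (List; []; _∷_; _++_; map; filterᵇ; null; length; downFrom; allFin; cartesianProduct)
open import Data.List.Membership.Propositional using (_∈_; _∉_)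
open import Data.List.Membership.Propositional.Properties using (∈-allFin; ∈-cartesianProduct⁺)
open import Data.List.Properties using (map-∘; map-++; map-cong; ++-assoc; length-tabulate)
open import Data.List.Relation.Unary.All as All using (All; []; _∷_)
import Data.List.Relation.Unary.All.Properties as All
open import Data.List.Relation.Unary.AllPairs using ([]; _∷_)
open import Data.List.Relation.Unary.Any using (here; there)
open import Data.List.Relation.Unary.Unique.Propositional using (Unique)
open import Data.List.Relation.Unary.Unique.Propositional.Properties using (allFin⁺)
open import Data.List.Relation.Binary.Permutation.Propositional
  using (_↭_; refl; prep; swap; ↭-refl; ↭-reflexive; ↭-sym; ↭-trans; ↭⇒↭ₛ)
open import Data.List.Relation.Binary.Permutation.Propositional.Properties
  using (map⁺; shift; shifts; ++⁺ˡ; ++⁺ʳ; ∈-resp-↭)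
import Data.List.Relation.Binary.Permutation.Setoid.Properties as Permutationₛ
open import Data.Product using (_×_; _,_; proj₁; map₂; ∃-syntax)
open import Data.Sum using (_⊎_; inj₁; inj₂; [_,_]′)
import Data.Vec as Vec
open import Data.Vec.Relation.Unary.All using ([]; _∷_)
open import Data.Vec.Relation.Unary.AllPairs using ([]; _∷_)
import Data.Vec.Relation.Unary.Unique.Propositional as Vec
open import Data.Vec.Relation.Unary.Unique.Propositional.Properties using (lookup-injective)
open import Function using (_∘_; id; Equivalence)
open import Relation.Binary.PropositionalEquality
  using (_≡_; _≢_; refl; sym; trans; cong; cong₂; subst; subst₂; setoid)
open import Relation.Nullary using (¬_; Dec; yes; no; does; contradiction)

-- Permutations and Boolean tests.

slide : ∀ {A : Set} (xs ys : List A) {zs L} → xs ++ zs ↭ L → xs ++ ys ++ zs ↭ ys ++ L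
slide xs ys p = ↭-trans (shifts xs ys) (++⁺ˡ ys p)

∧-true : ∀ {a b} → a ∧ b ≡ true → a ≡ true × b ≡ true
∧-true {true} {true} refl = refl , refl

∨-true : ∀ a {b} → a ∨ b ≡ true → a ≡ true ⊎ b ≡ true
∨-true true  _  = inj₁ refl
∨-true false eq = inj₂ eq

≡ᵇ-true : ∀ {m n} → (m ≡ᵇ n) ≡ true → m ≡ n
≡ᵇ-true eq = ≡ᵇ⇒≡ _ _ (Equivalence.from T-≡ eq)

Unique-resp-↭ : ∀ {A : Set} {xs ys : List A} → xs ↭ ys → Unique xs → Unique ys
Unique-resp-↭ {A} p = Permutationₛ.Unique-resp-↭ (setoid A) (↭⇒↭ₛ p)

-- Exchange arguments on few vertices

-- Vertices of a local configuration carry labels, and edges are unordered pairs of labels.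
Edge : Set
Edge = ℕ × ℕ

sameEdge : Edge → Edge → Bool
sameEdge (i , j) (k , l) = ((i ≡ᵇ k) ∧ (j ≡ᵇ l)) ∨ ((i ≡ᵇ l) ∧ (j ≡ᵇ k))

_∈ᵇ_ : Edge → List Edge → Bool
e ∈ᵇ p = any (sameEdge e) p

without : Edge → List Edge → List Edge
without e []      = []
without e (f ∷ p) = if sameEdge e f then without e p else f ∷ without e p

minus : List Edge → List Edge → List Edge
minus es []       = es
minus es (b ∷ bs) = minus (without b es) bs

totalWeight : List (ℕ × Edge) → ℕ
totalWeight os = sum (map proj₁ os)

-- Does every set of optional edges of weight at least t contain one of the sets in ps?
mutual
  search : List (ℕ × Edge) → ℕ → List (List Edge) → Bool
  search os t ps = any null ps ∨ ((totalWeight os <ᵇ t) ∨ branch os t ps)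

  branch : List (ℕ × Edge) → ℕ → List (List Edge) → Bool
  branch []             t ps = false
  branch ((w , e) ∷ os) t ps =
    search os (t ∸ w) (map (without e) ps) ∧ search os t (filterᵇ (not ∘ (e ∈ᵇ_)) ps)

remove : ℕ → List ℕ → List ℕ
remove x []       = []
remove x (y ∷ ys) = if x ≡ᵇ y then ys else y ∷ remove x ys

isPermutation : List ℕ → List ℕ → Bool
isPermutation []       ys = null ys
isPermutation (x ∷ xs) ys = any (x ≡ᵇ_) ys ∧ isPermutation xs (remove x ys)

-- An arrangement of m labels is coded by a decimal numeral with m digits;
-- labels and positions are both counted from the right, starting at 0.
digit : ℕ → ℕ → ℕ
digit c zero    = c % 10
digit c (suc i) = digit (c / 10) i

isArrangement : ℕ → ℕ → Bool
isArrangement m c = isPermutation (map (digit c) (downFrom m)) (downFrom m)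

Table : Set
Table = List (List Edge × List ℕ)

-- Position `i` of a shape is filled by the label `digit c i`. Edges already in `base` are struck
-- out, so that only those still to be found among the optional edges remain.
patterns : List Edge → Table → List (List Edge)
patterns base []                     = []
patterns base ((shape , cs) ∷ table) =
  map (λ c → minus (map (λ (i , j) → digit c i , digit c j) shape) base) cs ++ patterns base table

cross : List (ℕ × ℕ) → List ℕ → List (ℕ × Edge)
cross ds []       = []
cross ds (b ∷ bs) = map (λ (w , d) → w , d , b) ds ++ cross ds bs

-- Whenever the edges in base are present and the edges between the weighted labels in outer and
-- the labels in inner have weight at least threshold, some arrangement realises its shape.
record Exchange : Set where
  constructor rule
  field
    size      : ℕ
    base      : List Edge
    outer     : List (ℕ × ℕ)
    inner     : List ℕ
    threshold : ℕ
    table     : Table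
    valid     : all (λ (_ , cs) → all (isArrangement size) cs) table ≡ true
    found     : search (cross outer inner) threshold (patterns base table) ≡ true

-- An upper bound for the weight of os when the edges in ns are absent.
capacity : List Edge → List (ℕ × Edge) → ℕ
capacity ns []                 = 0
capacity ns ((w , i , j) ∷ os) =
  if (i ≡ᵇ j) ∨ ((i , j) ∈ᵇ ns) then capacity ns os else w + capacity ns os

-- Labels count from the right, so that `map (at x ys) (downFrom m)` computes to `x ∷ ys` when `m`
-- is its length. A label out of range falls to the last entry.
at : ∀ {A : Set} → A → List A → ℕ → A
at x []       i = x
at x (y ∷ ys) i = if i ≡ᵇ suc (length ys) then x else at y ys i

remove-↭ : ∀ x ys → any (x ≡ᵇ_) ys ≡ true → ys ↭ x ∷ remove x ys
remove-↭ x (y ∷ ys) h with x ≡ᵇ y in eq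
... | true  rewrite ≡ᵇ-true {x} {y} eq = ↭-refl
... | false = ↭-trans (prep y (remove-↭ x ys h)) (shift x (y ∷ []) _)

isPermutation-sound : ∀ xs ys → isPermutation xs ys ≡ true → xs ↭ ys
isPermutation-sound []       []  h = ↭-refl
isPermutation-sound (x ∷ xs) ys h with ∧-true h
... | x∈ys , h′ = ↭-trans (prep x (isPermutation-sound xs _ h′)) (↭-sym (remove-↭ x ys x∈ys))

arrange : ∀ {A : Set} (ρ : ℕ → A) m c → isArrangement m c ≡ true →
          map (ρ ∘ digit c) (downFrom m) ↭ map ρ (downFrom m)
arrange ρ m c h = subst (_↭ _) (sym (map-∘ (downFrom m)))
  (map⁺ ρ (isPermutation-sound _ _ h))

sameEdge-≡ : ∀ i j k l → sameEdge (i , j) (k , l) ≡ true → (i ≡ k × j ≡ l) ⊎ (i ≡ l × j ≡ k)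
sameEdge-≡ i j k l h with ∨-true ((i ≡ᵇ k) ∧ (j ≡ᵇ l)) h
... | inj₁ eq with ∧-true eq
...   | p , q = inj₁ (≡ᵇ-true p , ≡ᵇ-true q)
sameEdge-≡ i j k l h | inj₂ eq with ∧-true eq
...   | p , q = inj₂ (≡ᵇ-true p , ≡ᵇ-true q)

-- Shapes and exchange tables.

up : ℕ → List Edge → List Edge
up k = map (λ (i , j) → k + i , k + j)

cycle₃ cycle₄ path₃ path₄ paw linked : List Edge
cycle₃   = (2 , 1) ∷ (1 , 0) ∷ (0 , 2) ∷ []
path₃    = (2 , 1) ∷ (1 , 0) ∷ []
path₄    = (3 , 2) ∷ (2 , 1) ∷ (1 , 0) ∷ []
cycle₄   = path₄ ++ (0 , 3) ∷ []
paw      = path₄ ++ (3 , 1) ∷ []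
-- A triangle a b c and a path x z y with x adjacent to a, b, c and y adjacent to a, b.
linked   = up 3 cycle₃ ++ path₃ ++ (2 , 5) ∷ (2 , 4) ∷ (2 , 3) ∷ (0 , 5) ∷ (0 , 4) ∷ []

-- The arrangements in the following tables come from a computer search.
path₃+triangle-exchange : Exchange
path₃+triangle-exchange = rule 6 (up 3 path₃ ++ cycle₃)
  ((1 , 5) ∷ (1 , 3) ∷ []) (2 ∷ 1 ∷ 0 ∷ []) 5
  ((linked , 102345 ∷ 102543 ∷ 201345 ∷ 201543 ∷ 210345 ∷ 210543 ∷ []) ∷ [])
  refl refl

-- The labels 6, 5, 4 are x, z, y. The threshold 5 is the first load above 4, the share of one cycle
-- in the Ore inequality for x and y.
path₃+quad-exchange : Exchange
path₃+quad-exchange = rule 7 (up 4 path₃ ++ cycle₄)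
  ((1 , 6) ∷ (1 , 4) ∷ []) (3 ∷ 2 ∷ 1 ∷ 0 ∷ []) 5
  ((up 4 cycle₃ ++ path₄ ,
  4215603 ∷ 4215630 ∷ 4305612 ∷ 4305621 ∷ 6215403 ∷ 6215430 ∷ 6305412 ∷ 6305421 ∷ []) ∷ [])
  refl refl

-- The labels 8 down to 3 are a, b, c, x, z, y. The pair z c counts twice and x y once, and 13 is
-- the first load above 12, the share of one cycle in three Ore inequalities.
linked+triangle-exchange : Exchange
linked+triangle-exchange = rule 9 (up 3 linked ++ cycle₃)
  ((2 , 4) ∷ (2 , 6) ∷ (1 , 5) ∷ (1 , 3) ∷ []) (2 ∷ 1 ∷ 0 ∷ []) 13
  ((up 6 cycle₃ ++ up 3 cycle₃ ++ cycle₃ ,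
  873620541 ∷ 873621540 ∷ 873650421 ∷ 873651420 ∷ 873652410 ∷ 875610432 ∷ 875620431 ∷
  875621430 ∷ 876520431 ∷ 876521430 ∷ 876540321 ∷ 876541320 ∷ 876542310 ∷ []) ∷ [])
  refl refl

-- A paw is accepted as a second outcome: it has one edge more than the path and is treated
-- separately.
path₄+triangle-exchange : Exchange
path₄+triangle-exchange = rule 7 (up 3 path₄ ++ cycle₃)
  ((1 , 6) ∷ (1 , 5) ∷ (1 , 4) ∷ (1 , 3) ∷ []) (2 ∷ 1 ∷ 0 ∷ []) 8
  ((up 4 cycle₃ ++ cycle₄ ,
    3206541 ∷ 3216540 ∷ 4316502 ∷ 4316520 ∷ 4326501 ∷ 6205431 ∷ 6504312 ∷ 6504321 ∷
    6514302 ∷ 6514320 ∷ 6524310 ∷ []) ∷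
  (up 4 cycle₃ ++ paw ,
    3204156 ∷ 4312056 ∷ 4321056 ∷ 6103245 ∷ 6203145 ∷ 6205143 ∷ 6502134 ∷ 6502143 ∷
    6512034 ∷ 6512043 ∷ 6514302 ∷ 6514320 ∷ 6524301 ∷ []) ∷ [])
  refl refl

path₄+quad-exchange : Exchange
path₄+quad-exchange = rule 8 (up 4 path₄ ++ cycle₄)
  ((1 , 7) ∷ (1 , 6) ∷ (1 , 5) ∷ (1 , 4) ∷ []) (3 ∷ 2 ∷ 1 ∷ 0 ∷ []) 11
  ((up 4 cycle₄ ++ cycle₄ , 76125430 ∷ 76504321 ∷ 76514230 ∷ []) ∷
  (up 4 cycle₄ ++ paw ,
    42305167 ∷ 43015267 ∷ 43017265 ∷ 43215067 ∷ 43217065 ∷ 54017623 ∷ 54032167 ∷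
    54037612 ∷ 54107623 ∷ 54127603 ∷ 54213067 ∷ 54237601 ∷ 54237610 ∷ 54327601 ∷
    65407123 ∷ 65427103 ∷ 72304156 ∷ 72306154 ∷ 76013254 ∷ 76125403 ∷ 76213054 ∷
    76215403 ∷ 76504123 ∷ 76504321 ∷ 76514230 ∷ 76524301 ∷ []) ∷ [])
  refl refl

-- The labels 6, 5, 4, 3 are x, u, v, y. The pendant vertex y has weight 2 because it lies in both
-- nonadjacent pairs, y x and y u.
paw+triangle-exchange : Exchange
paw+triangle-exchange = rule 7 (up 3 paw ++ cycle₃)
  ((2 , 3) ∷ (1 , 6) ∷ (1 , 5) ∷ []) (2 ∷ 1 ∷ 0 ∷ []) 7
  ((up 4 cycle₃ ++ cycle₄ ,
  5106432 ∷ 5206431 ∷ 5216430 ∷ 6105432 ∷ 6205431 ∷ 6215430 ∷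
  6543120 ∷ 6543201 ∷ 6543210 ∷ []) ∷ [])
  refl refl

paw+quad-exchange : Exchange
paw+quad-exchange = rule 8 (up 4 paw ++ cycle₄)
  ((2 , 4) ∷ (1 , 7) ∷ (1 , 6) ∷ []) (3 ∷ 2 ∷ 1 ∷ 0 ∷ []) 13
  ((up 4 cycle₄ ++ cycle₄ , 75604321 ∷ 75614230 ∷ 75624301 ∷ 75634210 ∷ []) ∷ [])
  refl refl

-- Degree counts contradicting the Ore inequalities.

2+n≰n : ∀ n → ¬ (2 + n ≤ n)
2+n≰n n h = n≮n n (≤-trans (n≤1+n _) h)

-- The 6 comes from adjacencies inside the paw. Two Ore inequalities give 8r + 8s + 8, while 4s ≤ 2r
-- brings the upper bound down to 8r + 8s + 6.
paw-count : ∀ r s a b c → 4 * (r + suc s) ≤ a + b → 4 * (r + suc s) ≤ a + c → 2 * s ≤ r →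
    ¬ (2 * a + (1 * b + (1 * c + 0)) ≤ 6 + (6 * r + 12 * s))
paw-count r s a b c h₁ h₂ h₃ h = 2+n≰n (6 + (8 * r + 8 * s)) (begin
    2 + (6 + (8 * r + 8 * s))                    ≡⟨ e₁ r s ⟩
    4 * (r + suc s) + 4 * (r + suc s)      ≤⟨ +-mono-≤ h₁ h₂ ⟩
    (a + b) + (a + c)                      ≡⟨ e₂ a b c ⟩
    2 * a + (1 * b + (1 * c + 0))          ≤⟨ h ⟩
    6 + (6 * r + 12 * s)                   ≡⟨ e₃ r s ⟩
    6 + (6 * r + 8 * s) + 2 * (2 * s)      ≤⟨ +-monoʳ-≤ (6 + (6 * r + 8 * s)) (*-monoʳ-≤ 2 h₃) ⟩
    6 + (6 * r + 8 * s) + 2 * r            ≡⟨ e₄ r s ⟩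
    6 + (8 * r + 8 * s)                    ∎)
    where
    open ≤-Reasoning
    e₁ : ∀ r s → 2 + (6 + (8 * r + 8 * s)) ≡ 4 * (r + suc s) + 4 * (r + suc s)
    e₁ = solve-∀
    e₂ : ∀ a b c → (a + b) + (a + c) ≡ 2 * a + (1 * b + (1 * c + 0))
    e₂ = solve-∀
    e₃ : ∀ r s → 6 + (6 * r + 12 * s) ≡ 6 + (6 * r + 8 * s) + 2 * (2 * s)
    e₃ = solve-∀
    e₄ : ∀ r s → 6 + (6 * r + 8 * s) + 2 * r ≡ 6 + (8 * r + 8 * s)
    e₄ = solve-∀

path₄-count : ∀ r s a b c d → 4 * (r + suc s) ≤ a + c → 4 * (r + suc s) ≤ b + d → 2 * s ≤ r →
  ¬ (1 * a + (1 * b + (1 * c + (1 * d + 0))) ≤ 6 + (7 * r + 10 * s))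
path₄-count r s a b c d h₁ h₂ h₃ h = 2+n≰n (6 + (8 * r + 8 * s)) (begin
  2 + (6 + (8 * r + 8 * s))                 ≡⟨ e₁ r s ⟩
  4 * (r + suc s) + 4 * (r + suc s)         ≤⟨ +-mono-≤ h₁ h₂ ⟩
  (a + c) + (b + d)                         ≡⟨ e₂ a b c d ⟩
  1 * a + (1 * b + (1 * c + (1 * d + 0)))   ≤⟨ h ⟩
  6 + (7 * r + 10 * s)                      ≡⟨ e₃ r s ⟩
  6 + (7 * r + 8 * s) + 2 * s               ≤⟨ +-monoʳ-≤ (6 + (7 * r + 8 * s)) h₃ ⟩
  6 + (7 * r + 8 * s) + r                   ≡⟨ e₄ r s ⟩
  6 + (8 * r + 8 * s)                       ∎)
  where
  open ≤-Reasoning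
  e₁ : ∀ r s → 2 + (6 + (8 * r + 8 * s)) ≡ 4 * (r + suc s) + 4 * (r + suc s)
  e₁ = solve-∀
  e₂ : ∀ a b c d → (a + c) + (b + d) ≡ 1 * a + (1 * b + (1 * c + (1 * d + 0)))
  e₂ = solve-∀
  e₃ : ∀ r s → 6 + (7 * r + 10 * s) ≡ 6 + (7 * r + 8 * s) + 2 * s
  e₃ = solve-∀
  e₄ : ∀ r s → 6 + (7 * r + 8 * s) + r ≡ 6 + (8 * r + 8 * s)
  e₄ = solve-∀

-- Using x y once and z c twice gives 12r + 12s + 24, against 22 from inside the six linked vertices
-- and 12 for each other cycle.
linked-count : ∀ r s x y z c → 4 * (suc (suc r) + s) ≤ x + y → 4 * (suc (suc r) + s) ≤ z + c →
  ¬ (2 * z + (2 * c + (1 * x + (1 * y + 0))) ≤ 22 + (12 * r + 12 * s))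
linked-count r s x y z c h₁ h₂ h = 2+n≰n (22 + (12 * r + 12 * s)) (begin
  2 + (22 + (12 * r + 12 * s))             ≡⟨ e₁ r s ⟩
  K + (K + K)                              ≤⟨ +-mono-≤ h₁ (+-mono-≤ h₂ h₂) ⟩
  (x + y) + ((z + c) + (z + c))            ≡⟨ e₂ x y z c ⟩
  2 * z + (2 * c + (1 * x + (1 * y + 0)))  ≤⟨ h ⟩
  22 + (12 * r + 12 * s)                   ∎)
  where
  open ≤-Reasoning
  K = 4 * (suc (suc r) + s)
  e₁ : ∀ r s → 2 + (22 + (12 * r + 12 * s)) ≡
       4 * (suc (suc r) + s) + (4 * (suc (suc r) + s) + 4 * (suc (suc r) + s))
  e₁ = solve-∀
  e₂ : ∀ x y z c → (x + y) + ((z + c) + (z + c)) ≡ 2 * z + (2 * c + (1 * x + (1 * y + 0)))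
  e₂ = solve-∀

path₃-count : ∀ r s x y → 4 * (suc r + s) ≤ x + y →
  ¬ (1 * x + (1 * y + 0) ≤ 2 + (4 * r + 4 * s))
path₃-count r s x y h₁ h = 2+n≰n (2 + (4 * r + 4 * s)) (begin
  2 + (2 + (4 * r + 4 * s))  ≡⟨ e₁ r s ⟩
  4 * (suc r + s)            ≤⟨ h₁ ⟩
  x + y                      ≡⟨ e₂ x y ⟩
  1 * x + (1 * y + 0)        ≤⟨ h ⟩
  2 + (4 * r + 4 * s)        ∎)
  where
  open ≤-Reasoning
  e₁ : ∀ r s → 2 + (2 + (4 * r + 4 * s)) ≡ 4 * (suc r + s)
  e₁ = solve-∀
  e₂ : ∀ x y → x + y ≡ 1 * x + (1 * y + 0)
  e₂ = solve-∀

-- The condition r ≥ 2s - 2 is carried without subtraction. With one quadrilateral set aside it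
-- bounds the number of the others, as the degree counts require.
halve-bound : ∀ {r s} → 2 * suc s ≤ 2 + r → 2 * s ≤ r
halve-bound {r} {s} h = +-cancelˡ-≤ 2 _ _ (subst (_≤ 2 + r) (*-suc 2 s) h)

-- Soundness of the exchange search in a graph.

module _ {n} (H : Graph n) where

  Adj-sym : ∀ {x y} → Adj H x y → Adj H y x
  Adj-sym {x} {y} h = trans (symmetric H y x) h

  adj# : Fin n → Fin n → ℕ
  adj# x y = if adj H x y then 1 else 0

  Holds : (ℕ → Fin n) → Edge → Set
  Holds ρ (i , j) = Adj H (ρ i) (ρ j)

  load : List (ℕ × Fin n) → Fin n → ℕ
  load ds v = sum (map (λ (w , x) → w * adj# x v) ds)

  edgeLoad : (ℕ → Fin n) → List (ℕ × Edge) → ℕ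
  edgeLoad ρ os = sum (map (λ (w , i , j) → w * adj# (ρ i) (ρ j)) os)

  adj#≤1 : ∀ x y → adj# x y ≤ 1
  adj#≤1 x y with adj H x y
  ... | true  = ≤-refl
  ... | false = z≤n

  adj#-nonadjacent : ∀ {x y} → ¬ Adj H x y → adj# x y ≡ 0
  adj#-nonadjacent {x} {y} x≁y with adj H x y
  ... | true  = contradiction refl x≁y
  ... | false = refl

  -- Identifies the weight that the search sees on labelled edges with the load that degree counting
  -- measures on vertices.
  edgeLoad-cross : ∀ ρ ds bs →
    edgeLoad ρ (cross ds bs) ≡ sum (map (load (map (map₂ ρ) ds)) (map ρ bs))
  edgeLoad-cross ρ ds []       = refl
  edgeLoad-cross ρ ds (b ∷ bs) = trans
    (trans (cong sum (map-++ _ (map (λ (w , d) → w , d , b) ds) (cross ds bs)))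
           (sum-++ (map _ (map (λ (w , d) → w , d , b) ds)) _))
    (cong₂ _+_ (cong sum (trans (sym (map-∘ ds)) (map-∘ ds))) (edgeLoad-cross ρ ds bs))

  module _ (ρ : ℕ → Fin n) where

    sameEdge-resp : ∀ e f → sameEdge e f ≡ true → Holds ρ e → Holds ρ f
    sameEdge-resp (i , j) (k , l) h with sameEdge-≡ i j k l h
    ... | inj₁ (refl , refl) = id
    ... | inj₂ (refl , refl) = Adj-sym

    without-sound : ∀ e p → Holds ρ e → All (Holds ρ) (without e p) → All (Holds ρ) p
    without-sound e []      he h = []
    without-sound e (f ∷ p) he h with sameEdge e f in eq
    without-sound e (f ∷ p) he h        | true  = sameEdge-resp e f eq he ∷ without-sound e p he h
    without-sound e (f ∷ p) he (hf ∷ h) | false = hf ∷ without-sound e p he h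

    minus-sound : ∀ es bs → All (Holds ρ) bs → All (Holds ρ) (minus es bs) → All (Holds ρ) es
    minus-sound es []       []         h = h
    minus-sound es (b ∷ bs) (hb ∷ hbs) h =
      without-sound b es hb (minus-sound (without b es) bs hbs h)

    edgeLoad≤totalWeight : ∀ os → edgeLoad ρ os ≤ totalWeight os
    edgeLoad≤totalWeight []                 = z≤n
    edgeLoad≤totalWeight ((w , i , j) ∷ os) = +-mono-≤
      (≤-trans (*-monoʳ-≤ w (adj#≤1 (ρ i) (ρ j))) (≤-reflexive (*-identityʳ w)))
      (edgeLoad≤totalWeight os)

    ∈ᵇ-nonadjacent : ∀ e ns → (e ∈ᵇ ns) ≡ true → All (¬_ ∘ Holds ρ) ns → ¬ Holds ρ e
    ∈ᵇ-nonadjacent e (f ∷ ns) h (¬f ∷ ¬ns) with ∨-true (sameEdge e f) h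
    ... | inj₁ eq = ¬f ∘ sameEdge-resp e f eq
    ... | inj₂ h′ = ∈ᵇ-nonadjacent e ns h′ ¬ns

    capacity-sound : ∀ ns os → All (¬_ ∘ Holds ρ) ns → edgeLoad ρ os ≤ capacity ns os
    capacity-sound ns []                 ¬ns = z≤n
    capacity-sound ns ((w , i , j) ∷ os) ¬ns with (i ≡ᵇ j) ∨ ((i , j) ∈ᵇ ns) in eq
    ... | false = +-mono-≤
      (≤-trans (*-monoʳ-≤ w (adj#≤1 (ρ i) (ρ j))) (≤-reflexive (*-identityʳ w)))
      (capacity-sound ns os ¬ns)
    ... | true = ≤-trans
      (≤-reflexive (cong (_+ edgeLoad ρ os)
        (trans (cong (w *_) (adj#-nonadjacent ij≁)) (*-zeroʳ w))))
      (capacity-sound ns os ¬ns)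
      where
      ij≁ : ¬ Adj H (ρ i) (ρ j)
      ij≁ with ∨-true (i ≡ᵇ j) eq
      ... | inj₂ h = ∈ᵇ-nonadjacent (i , j) ns h ¬ns
      ... | inj₁ h rewrite ≡ᵇ-true {i} {j} h =
        λ loop → contradiction (trans (sym loop) (irreflex H (ρ j))) λ ()

    module _ {Goal : Set} where

      -- Patterns enter in continuation form, so whichever one the search completes yields the goal
      -- at once.
      Leads : List Edge → Set
      Leads p = All (Holds ρ) p → Goal

      null-sound : ∀ ps → any null ps ≡ true → All Leads ps → Goal
      null-sound ([] ∷ ps)      h (k ∷ ks) = k []
      null-sound ((_ ∷ _) ∷ ps) h (k ∷ ks) = null-sound ps h ks

      mutual
        -- The decision tree of `search` is followed along the actual adjacencies. A leaf either has
        -- a completed pattern or contradicts the lower bound on the load.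
        search-sound : ∀ os t ps → search os t ps ≡ true → t ≤ edgeLoad ρ os → All Leads ps → Goal
        search-sound os t ps h t≤ ks with ∨-true (any null ps) h
        ... | inj₁ h′ = null-sound ps h′ ks
        ... | inj₂ h′ with ∨-true (totalWeight os <ᵇ t) h′
        ...   | inj₂ h″ = branch-sound os t ps h″ t≤ ks
        ...   | inj₁ h″ = contradiction
          (<-≤-trans (<ᵇ⇒< (totalWeight os) t (Equivalence.from T-≡ h″))
                     (≤-trans t≤ (edgeLoad≤totalWeight os)))
          (n≮n _)

        branch-sound : ∀ os t ps → branch os t ps ≡ true → t ≤ edgeLoad ρ os → All Leads ps → Goal
        -- A present edge lowers the threshold by its weight and is struck out of the patterns; an
        -- absent edge eliminates the patterns that need it.
        branch-sound ((w , e@(i , j)) ∷ os) t ps h t≤ ks with ∧-true h | adj H (ρ i) (ρ j) in eq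
        ... | h₁ , _ | true  = search-sound os (t ∸ w) (map (without e) ps) h₁
          (m≤n+o⇒m∸n≤o t w (subst (λ k → t ≤ k + edgeLoad ρ os)
            (trans (cong (w *_) (cong (if_then 1 else 0) eq)) (*-identityʳ w)) t≤))
          (All.map⁺ (All.map (λ {p} k hp → k (without-sound e p eq hp)) ks))
        ... | _ , h₂ | false = search-sound os t _ h₂
          (subst (λ k → t ≤ k + edgeLoad ρ os)
            (trans (cong (w *_) (cong (if_then 1 else 0) eq)) (*-zeroʳ w)) t≤)
          (All.filter⁺ (T? ∘ not ∘ (e ∈ᵇ_)) ks)

    Found : ℕ → List Edge → Set
    Found m shape = ∃[ τ ] map τ (downFrom m) ↭ map ρ (downFrom m) × All (Holds τ) shape

    module _ (R : Exchange) where
      open Exchange R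

      -- Turns a table checked by computation into an exchange in `H`: each shape comes with a way
      -- to finish once it is found on the same vertices.
      exchange : ∀ {Goal : Set} → All (Holds ρ) base →
        threshold ≤ sum (map (load (map (map₂ ρ) outer)) (map ρ inner)) →
        All (λ (shape , _) → Found size shape → Goal) table → Goal
      exchange {Goal} hbase t≤ ks = search-sound
        (cross outer inner) threshold (patterns base table) found
        (≤-trans t≤ (≤-reflexive (sym (edgeLoad-cross ρ outer inner)))) (leads table valid ks)
        where
        leadsCodes : ∀ shape cs → all (isArrangement size) cs ≡ true → (Found size shape → Goal) →
          All Leads (map (λ c → minus (map (λ (i , j) → digit c i , digit c j) shape) base) cs)
        leadsCodes shape []       _ k = []
        leadsCodes shape (c ∷ cs) v k with ∧-true v
        ... | vc , vcs = (λ hp → k (ρ ∘ digit c , arrange ρ size c vc ,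
                            All.map⁻ (minus-sound _ base hbase hp))) ∷ leadsCodes shape cs vcs k

        leads : ∀ table → all (λ (_ , cs) → all (isArrangement size) cs) table ≡ true →
          All (λ (shape , _) → Found size shape → Goal) table → All Leads (patterns base table)
        leads []                     _ []       = []
        leads ((shape , cs) ∷ table) v (k ∷ ks) with ∧-true v
        ... | vcs , vt = All.++⁺ (leadsCodes shape cs vcs k) (leads table vt ks)

  -- Weighted degree counting

  Triangle : Fin n → Fin n → Fin n → Set
  Triangle a b c = Adj H a b × Adj H b c × Adj H c a

  Quad : Fin n → Fin n → Fin n → Fin n → Set
  Quad a b c d = Adj H a b × Adj H b c × Adj H c d × Adj H d a

  -- The cycles partition the listed vertices; `perm` makes the order of the list immaterial.
  data Pack : ℕ → ℕ → List (Fin n) → Set where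
    nil  : Pack 0 0 []
    tri  : ∀ {r s L a b c} → Triangle a b c → Pack r s L → Pack (suc r) s (a ∷ b ∷ c ∷ L)
    quad : ∀ {r s L a b c d} → Quad a b c d → Pack r s L → Pack r (suc s) (a ∷ b ∷ c ∷ d ∷ L)
    perm : ∀ {r s L L′} → L ↭ L′ → Pack r s L → Pack r s L′

  data Heavy (f : Fin n → ℕ) (A B : ℕ) : ℕ → ℕ → List (Fin n) → Set where
    tri   : ∀ {r s L L′ a b c} → Triangle a b c → Pack r s L′ → a ∷ b ∷ c ∷ L′ ↭ L →
            A < sum (map f (a ∷ b ∷ c ∷ [])) → Heavy f A B (suc r) s L
    quad  : ∀ {r s L L′ a b c d} → Quad a b c d → Pack r s L′ → a ∷ b ∷ c ∷ d ∷ L′ ↭ L →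
            B < sum (map f (a ∷ b ∷ c ∷ d ∷ [])) → Heavy f A B r (suc s) L
    light : ∀ {r s L} → sum (map f L) ≤ A * r + B * s → Heavy f A B r s L

  sum-map-++ : ∀ (f : Fin n → ℕ) xs ys → sum (map f (xs ++ ys)) ≡ sum (map f xs) + sum (map f ys)
  sum-map-++ f xs ys = trans (cong sum (map-++ f xs ys)) (sum-++ (map f xs) (map f ys))

  -- Pigeonhole: if no triangle exceeds `A` and no quadrilateral exceeds `B`, summing over the
  -- cycles bounds the total. A heavy cycle is moved to the front, ready for an exchange.
  findHeavy : ∀ f A B {r s L} → Pack r s L → Heavy f A B r s L
  findHeavy f A B nil = light z≤n
  findHeavy f A B (perm p P) with findHeavy f A B P
  ... | tri t P′ q h  = tri t P′ (↭-trans q p) h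
  ... | quad t P′ q h = quad t P′ (↭-trans q p) h
  ... | light h       = light (subst (_≤ _) (sum-↭ (map⁺ f p)) h)
  findHeavy f A B {suc r} {s} (tri {L = L} {a} {b} {c} t P) with A <? sum (map f (a ∷ b ∷ c ∷ []))
  ... | yes h = tri t P ↭-refl h
  ... | no ≤A with findHeavy f A B P
  ...   | tri t′ P′ q h  = tri t′ (tri t P′) (slide (_ ∷ _ ∷ _ ∷ []) (a ∷ b ∷ c ∷ []) q) h
  ...   | quad t′ P′ q h = quad t′ (tri t P′) (slide (_ ∷ _ ∷ _ ∷ _ ∷ []) (a ∷ b ∷ c ∷ []) q) h
  ...   | light h        = light (begin
    sum (map f (a ∷ b ∷ c ∷ L))               ≡⟨ sum-map-++ f (a ∷ b ∷ c ∷ []) L ⟩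
    sum (map f (a ∷ b ∷ c ∷ [])) + sum (map f L) ≤⟨ +-mono-≤ (≮⇒≥ ≤A) h ⟩
    A + (A * r + B * s)                       ≡⟨ rearranged A B r s ⟩
    A * suc r + B * s                         ∎)
    where
    open ≤-Reasoning
    rearranged : ∀ A B r s → A + (A * r + B * s) ≡ A * suc r + B * s
    rearranged = solve-∀
  findHeavy f A B {r} {suc s} (quad {L = L} {a} {b} {c} {d} t P)
    with B <? sum (map f (a ∷ b ∷ c ∷ d ∷ []))
  ... | yes h = quad t P ↭-refl h
  ... | no ≤B with findHeavy f A B P
  ...   | tri t′ P′ q h  = tri t′ (quad t P′) (slide (_ ∷ _ ∷ _ ∷ []) (a ∷ b ∷ c ∷ d ∷ []) q) h
  ...   | quad t′ P′ q h = quad t′ (quad t P′) (slide (_ ∷ _ ∷ _ ∷ _ ∷ []) (a ∷ b ∷ c ∷ d ∷ []) q) h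
  ...   | light h        = light (begin
    sum (map f (a ∷ b ∷ c ∷ d ∷ L))                  ≡⟨ sum-map-++ f (a ∷ b ∷ c ∷ d ∷ []) L ⟩
    sum (map f (a ∷ b ∷ c ∷ d ∷ [])) + sum (map f L) ≤⟨ +-mono-≤ (≮⇒≥ ≤B) h ⟩
    B + (A * r + B * s)                              ≡⟨ rearranged A B r s ⟩
    A * r + B * suc s                                ∎)
    where
    open ≤-Reasoning
    rearranged : ∀ A B r s → B + (A * r + B * s) ≡ A * r + B * suc s
    rearranged = solve-∀

  degreeIn : List (Fin n) → Fin n → ℕ
  degreeIn vs x = sum (map (adj# x) vs)

  weightedDegree : List (ℕ × Fin n) → List (Fin n) → ℕ
  weightedDegree ds vs = sum (map (λ (w , x) → w * degreeIn vs x) ds)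

  -- Double counting: the order of summation is interchanged.
  sum-load : ∀ ds vs → sum (map (load ds) vs) ≡ weightedDegree ds vs
  sum-load ds []       = sym (zeros ds)
    where
    zeros : ∀ ds → weightedDegree ds [] ≡ 0
    zeros []             = refl
    zeros ((w , x) ∷ ds) = cong₂ _+_ (*-zeroʳ w) (zeros ds)
  sum-load ds (v ∷ vs) = trans (cong (load ds v +_) (sum-load ds vs)) (split ds)
    where
    interchange : ∀ w a b c d → (w * a + c) + (w * b + d) ≡ w * (a + b) + (c + d)
    interchange = solve-∀
    split : ∀ ds → load ds v + weightedDegree ds vs ≡ weightedDegree ds (v ∷ vs)
    split []             = refl
    split ((w , x) ∷ ds) = trans
      (interchange w (adj# x v) (degreeIn vs x) (load ds v) (weightedDegree ds vs))
      (cong (w * degreeIn (v ∷ vs) x +_) (split ds))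

  degree≡degreeIn : ∀ x → degree H x ≡ degreeIn (allFin n) x
  degree≡degreeIn x = go id
    where
    go : ∀ {m} (f : Fin m → Fin n) →
      Vec.count (λ y → Data.Bool._≟_ (adj H x y) true) (Vec.tabulate f) ≡
      degreeIn (Data.List.tabulate f) x
    go {zero}  f = refl
    go {suc m} f with adj H x (f zero)
    ... | true  = cong suc (go (f ∘ suc))
    ... | false = go (f ∘ suc)

  degreeSum : List (ℕ × Fin n) → ℕ
  degreeSum ds = sum (map (λ (w , x) → w * degree H x) ds)

  degreeSum≡ : ∀ ds → degreeSum ds ≡ sum (map (load ds) (allFin n))
  degreeSum≡ ds = trans (cong sum (map-cong (λ (w , x) → cong (w *_) (degree≡degreeIn x)) ds))
    (sym (sum-load ds (allFin n)))

  -- Neighbours are split into those in the spoiled part and those in `L`. Inside the part, `cross`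
  -- pairs the labels with themselves, and `capacity` drops loops and the known nonadjacent pairs.
  degreeSum-bound : ∀ ρ k ds ns {L m} → map ρ (downFrom k) ++ L ↭ allFin n →
    All (¬_ ∘ Holds ρ) ns → sum (map (load (map (map₂ ρ) ds)) L) ≤ m →
    degreeSum (map (map₂ ρ) ds) ≤ capacity ns (cross ds (downFrom k)) + m
  degreeSum-bound ρ k ds ns {L} {m} π ¬ns h = begin
    degreeSum ds′                                ≡⟨ degreeSum≡ ds′ ⟩
    sum (map (load ds′) (allFin n))              ≡⟨ sum-↭ (map⁺ (load ds′) π) ⟨
    sum (map (load ds′) (D ++ L))                ≡⟨ sum-map-++ (load ds′) D L ⟩
    sum (map (load ds′) D) + sum (map (load ds′) L)
      ≤⟨ +-mono-≤ (≤-trans (≤-reflexive (sym (edgeLoad-cross ρ ds (downFrom k))))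
                           (capacity-sound ρ ns (cross ds (downFrom k)) ¬ns)) h ⟩
    capacity ns (cross ds (downFrom k)) + m      ∎
    where
    open ≤-Reasoning
    ds′ = map (map₂ ρ) ds
    D = map ρ (downFrom k)

  adj? : ∀ x y → Dec (Adj H x y)
  adj? x y = Data.Bool._≟_ (adj H x y) true

  unique : ∀ {L} → L ↭ allFin n → Unique L
  unique π = Unique-resp-↭ (↭-sym π) (allFin⁺ n)

  -- For n = 3r + 4s, the bound n + r equals 4(r + s), that is, four per cycle.
  Ore : ℕ → ℕ → Set
  Ore r s = σ₂≥ H (4 * (r + s))

  regroup : ∀ ρ m c {L} → isArrangement m c ≡ true → map ρ (downFrom m) ++ L ↭ allFin n →
    map (ρ ∘ digit c) (downFrom m) ++ L ↭ allFin n
  regroup ρ m c h = ↭-trans (++⁺ʳ _ (arrange ρ m c h))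

  -- Bookkeeping after an exchange: `D` is the spoiled part, `bs` the cycle used, and `ws` their
  -- vertices rearranged.
  insert : ∀ D {L L′ ws bs} → ws ↭ D ++ bs → bs ++ L′ ↭ L → D ++ L ↭ allFin n → ws ++ L′ ↭ allFin n
  insert D {L′ = L′} {bs = bs} p q π = ↭-trans (++⁺ʳ L′ p)
    (↭-trans (↭-reflexive (++-assoc D bs L′)) (↭-trans (++⁺ˡ D q) π))

  -- Completing a paw, path or linked configuration

  completePaw : ∀ {r s L x u v y} → Ore r (suc s) → 2 * s ≤ r → Pack r s L →
    All (Holds (at x (u ∷ v ∷ y ∷ []))) paw → x ∷ u ∷ v ∷ y ∷ L ↭ allFin n →
    Pack r (suc s) (allFin n)
  completePaw {r} {s} {L} {x} {u} {v} {y} ore 2s≤r P (xu ∷ uv ∷ vy ∷ xv ∷ []) π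
    with adj? y x | adj? y u
  ... | yes yx | _      = perm π (quad (xu , uv , vy , yx) P)
  -- The quadrilateral is x v y u.
  ... | no  _  | yes yu = perm (regroup (at x (u ∷ v ∷ y ∷ [])) 4 3102 refl π)
                               (quad (xv , vy , yu , Adj-sym xu) P)
  -- The caps 6 and 12 lie one below the thresholds of the two paw exchanges.
  ... | no y≁x | no y≁u with findHeavy (load ((2 , y) ∷ (1 , x) ∷ (1 , u) ∷ [])) 6 12 P
  ...   | tri {a = a} {b} {c} (ab , bc , ca) P′ q h =
            exchange (at x (u ∷ v ∷ y ∷ a ∷ b ∷ c ∷ [])) paw+triangle-exchange
            (xu ∷ uv ∷ vy ∷ xv ∷ ab ∷ bc ∷ ca ∷ []) h
            ((λ { (τ , p , t₁ ∷ t₂ ∷ t₃ ∷ q₁ ∷ q₂ ∷ q₃ ∷ q₄ ∷ []) →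
               perm (insert (x ∷ u ∷ v ∷ y ∷ []) p q π)
                    (tri (t₁ , t₂ , t₃) (quad (q₁ , q₂ , q₃ , q₄) P′)) }) ∷ [])
  ...   | quad {a = a} {b} {c} {d} (ab , bc , cd , da) P′ q h =
            exchange (at x (u ∷ v ∷ y ∷ a ∷ b ∷ c ∷ d ∷ [])) paw+quad-exchange
            (xu ∷ uv ∷ vy ∷ xv ∷ ab ∷ bc ∷ cd ∷ da ∷ []) h
            ((λ { (τ , p , t₁ ∷ t₂ ∷ t₃ ∷ t₄ ∷ q₁ ∷ q₂ ∷ q₃ ∷ q₄ ∷ []) →
               perm (insert (x ∷ u ∷ v ∷ y ∷ []) p q π)
                    (quad (t₁ , t₂ , t₃ , t₄) (quad (q₁ , q₂ , q₃ , q₄) P′)) }) ∷ [])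
  ...   | light h with unique π
  ...     | (_ ∷ _ ∷ x≢y ∷ _) ∷ (_ ∷ u≢y ∷ _) ∷ _ = contradiction
            (degreeSum-bound (at x (u ∷ v ∷ y ∷ [])) 4 ((2 , 0) ∷ (1 , 3) ∷ (1 , 2) ∷ [])
              ((0 , 3) ∷ (0 , 2) ∷ []) π (y≁x ∷ y≁u ∷ []) h)
            (paw-count r s (degree H y) (degree H x) (degree H u)
              (ore y x (x≢y ∘ sym) y≁x) (ore y u (u≢y ∘ sym) y≁u) 2s≤r)

  completePath₄ : ∀ {r s L x u v y} → Ore r (suc s) → 2 * s ≤ r → Pack r s L →
    All (Holds (at x (u ∷ v ∷ y ∷ []))) path₄ → x ∷ u ∷ v ∷ y ∷ L ↭ allFin n →
    Pack r (suc s) (allFin n)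
  completePath₄ {r} {s} {L} {x} {u} {v} {y} ore 2s≤r P (xu ∷ uv ∷ vy ∷ []) π
    with adj? y x | adj? x v | adj? u y
  ... | yes yx | _      | _      = perm π (quad (xu , uv , vy , yx) P)
  ... | no _   | yes xv | _      = completePaw ore 2s≤r P (xu ∷ uv ∷ vy ∷ xv ∷ []) π
  -- Read backwards, y v u x is a path whose triangle is y v u.
  ... | no _   | no _   | yes uy = completePaw ore 2s≤r P
          (Adj-sym vy ∷ Adj-sym uv ∷ Adj-sym xu ∷ Adj-sym uy ∷ [])
          (regroup (at x (u ∷ v ∷ y ∷ [])) 4 0123 refl π)
  ... | no y≁x | no x≁v | no u≁y
    with findHeavy (load ((1 , x) ∷ (1 , u) ∷ (1 , v) ∷ (1 , y) ∷ [])) 7 10 P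
  ...   | tri {a = a} {b} {c} (ab , bc , ca) P′ q h =
            exchange (at x (u ∷ v ∷ y ∷ a ∷ b ∷ c ∷ [])) path₄+triangle-exchange
            (xu ∷ uv ∷ vy ∷ ab ∷ bc ∷ ca ∷ []) h
            ((λ { (τ , p , t₁ ∷ t₂ ∷ t₃ ∷ q₁ ∷ q₂ ∷ q₃ ∷ q₄ ∷ []) →
               perm (insert (x ∷ u ∷ v ∷ y ∷ []) p q π)
                    (tri (t₁ , t₂ , t₃) (quad (q₁ , q₂ , q₃ , q₄) P′)) }) ∷
             (λ { (τ , p , t₁ ∷ t₂ ∷ t₃ ∷ p₁ ∷ p₂ ∷ p₃ ∷ p₄ ∷ []) →
               completePaw ore 2s≤r (tri (t₁ , t₂ , t₃) P′) (p₁ ∷ p₂ ∷ p₃ ∷ p₄ ∷ [])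
                 (↭-trans (shifts (τ 3 ∷ τ 2 ∷ τ 1 ∷ τ 0 ∷ []) (τ 6 ∷ τ 5 ∷ τ 4 ∷ []))
                          (insert (x ∷ u ∷ v ∷ y ∷ []) p q π)) }) ∷ [])
  ...   | quad {a = a} {b} {c} {d} (ab , bc , cd , da) P′ q h =
            exchange (at x (u ∷ v ∷ y ∷ a ∷ b ∷ c ∷ d ∷ [])) path₄+quad-exchange
            (xu ∷ uv ∷ vy ∷ ab ∷ bc ∷ cd ∷ da ∷ []) h
            ((λ { (τ , p , t₁ ∷ t₂ ∷ t₃ ∷ t₄ ∷ q₁ ∷ q₂ ∷ q₃ ∷ q₄ ∷ []) →
               perm (insert (x ∷ u ∷ v ∷ y ∷ []) p q π)
                    (quad (t₁ , t₂ , t₃ , t₄) (quad (q₁ , q₂ , q₃ , q₄) P′)) }) ∷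
             (λ { (τ , p , t₁ ∷ t₂ ∷ t₃ ∷ t₄ ∷ p₁ ∷ p₂ ∷ p₃ ∷ p₄ ∷ []) →
               completePaw ore 2s≤r (quad (t₁ , t₂ , t₃ , t₄) P′) (p₁ ∷ p₂ ∷ p₃ ∷ p₄ ∷ [])
                 (↭-trans (shifts (τ 3 ∷ τ 2 ∷ τ 1 ∷ τ 0 ∷ []) (τ 7 ∷ τ 6 ∷ τ 5 ∷ τ 4 ∷ []))
                          (insert (x ∷ u ∷ v ∷ y ∷ []) p q π)) }) ∷ [])
  ...   | light h with unique π
  ...     | (_ ∷ x≢v ∷ _) ∷ (_ ∷ u≢y ∷ _) ∷ _ = contradiction
            (degreeSum-bound (at x (u ∷ v ∷ y ∷ [])) 4 ((1 , 3) ∷ (1 , 2) ∷ (1 , 1) ∷ (1 , 0) ∷ [])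
              ((0 , 3) ∷ (3 , 1) ∷ (2 , 0) ∷ []) π (y≁x ∷ x≁v ∷ u≁y ∷ []) h)
            (path₄-count r s (degree H x) (degree H u) (degree H v) (degree H y)
              (ore x v x≢v x≁v) (ore u y u≢y u≁y) 2s≤r)

  path₃+quad : ∀ {r s L x z y a b c d} → Ore (suc r) (suc s) → 2 * s ≤ suc r → Pack r s L →
    Adj H x z → Adj H z y → Quad a b c d → x ∷ z ∷ y ∷ a ∷ b ∷ c ∷ d ∷ L ↭ allFin n →
    5 ≤ sum (map (load ((1 , x) ∷ (1 , y) ∷ [])) (a ∷ b ∷ c ∷ d ∷ [])) →
    Pack (suc r) (suc s) (allFin n)
  path₃+quad {x = x} {z} {y} {a} {b} {c} {d} ore 2s≤r P xz zy (ab , bc , cd , da) π h =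
    exchange (at x (z ∷ y ∷ a ∷ b ∷ c ∷ d ∷ [])) path₃+quad-exchange
      (xz ∷ zy ∷ ab ∷ bc ∷ cd ∷ da ∷ []) h
      ((λ { (τ , p , t₁ ∷ t₂ ∷ t₃ ∷ p₁ ∷ p₂ ∷ p₃ ∷ []) →
         completePath₄ ore 2s≤r (tri (t₁ , t₂ , t₃) P) (p₁ ∷ p₂ ∷ p₃ ∷ [])
           (↭-trans (shifts (τ 3 ∷ τ 2 ∷ τ 1 ∷ τ 0 ∷ []) (τ 6 ∷ τ 5 ∷ τ 4 ∷ []))
                    (↭-trans (++⁺ʳ _ p) π)) }) ∷ [])

  -- If both pairs had load at most 4, the weighted load would be at most 4 + 2 · 4 = 12.
  heavyPair : ∀ z c x y q →
    13 ≤ sum (map (load ((2 , z) ∷ (2 , c) ∷ (1 , x) ∷ (1 , y) ∷ [])) q) →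
    5 ≤ sum (map (load ((1 , x) ∷ (1 , y) ∷ [])) q) ⊎
    5 ≤ sum (map (load ((1 , z) ∷ (1 , c) ∷ [])) q)
  heavyPair z c x y q h with 5 ≤? sum (map (load ((1 , x) ∷ (1 , y) ∷ [])) q)
                           | 5 ≤? sum (map (load ((1 , z) ∷ (1 , c) ∷ [])) q)
  ... | yes h₁ | _      = inj₁ h₁
  ... | no _   | yes h₂ = inj₂ h₂
  ... | no h₁  | no h₂  = contradiction (≤-trans h (begin
    sum (map (load ((2 , z) ∷ (2 , c) ∷ (1 , x) ∷ (1 , y) ∷ [])) q)
      ≡⟨ sum-load ((2 , z) ∷ (2 , c) ∷ (1 , x) ∷ (1 , y) ∷ []) q ⟩
    2 * Z + (2 * C + (1 * X + (1 * Y + 0)))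
      ≡⟨ split X Y Z C ⟩
    (1 * X + (1 * Y + 0)) + 2 * (1 * Z + (1 * C + 0))
      ≡⟨ cong₂ (λ m k → m + 2 * k) (sum-load ((1 , x) ∷ (1 , y) ∷ []) q)
                                   (sum-load ((1 , z) ∷ (1 , c) ∷ []) q) ⟨
    sum (map (load ((1 , x) ∷ (1 , y) ∷ [])) q) + 2 * sum (map (load ((1 , z) ∷ (1 , c) ∷ [])) q)
      ≤⟨ +-mono-≤ (≤-pred (≰⇒> h₁)) (*-monoʳ-≤ 2 (≤-pred (≰⇒> h₂))) ⟩
    12 ∎)) (n≮n 12)
    where
    open ≤-Reasoning
    X = degreeIn q x
    Y = degreeIn q y
    Z = degreeIn q z
    C = degreeIn q c
    split : ∀ X Y Z C → 2 * Z + (2 * C + (1 * X + (1 * Y + 0))) ≡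
            (1 * X + (1 * Y + 0)) + 2 * (1 * Z + (1 * C + 0))
    split = solve-∀

  -- The argument `inside` isolates the bound 22 within the six vertices, whose proof depends on
  -- which further edge is missing.
  linkedExchange : ∀ {r s L a b c x z y} → Ore (suc (suc r)) s →
    2 * s ≤ 2 + suc (suc r) → Pack r s L →
    All (Holds (at a (b ∷ c ∷ x ∷ z ∷ y ∷ []))) linked → a ∷ b ∷ c ∷ x ∷ z ∷ y ∷ L ↭ allFin n →
    ¬ Adj H x y → ¬ Adj H z c →
    (∀ {m} → sum (map (load ((2 , z) ∷ (2 , c) ∷ (1 , x) ∷ (1 , y) ∷ [])) L) ≤ m →
      degreeSum ((2 , z) ∷ (2 , c) ∷ (1 , x) ∷ (1 , y) ∷ []) ≤ 22 + m) →
    Pack (suc (suc r)) s (allFin n)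
  linkedExchange {r} {s} {L} {a} {b} {c} {x} {z} {y} ore bound P
    (ab ∷ bc ∷ ca ∷ xz ∷ zy ∷ xa ∷ xb ∷ xc ∷ ya ∷ yb ∷ []) π x≁y z≁c inside
    with findHeavy (load ((2 , z) ∷ (2 , c) ∷ (1 , x) ∷ (1 , y) ∷ [])) 12 12 P
  ... | tri {a = d} {e} {f} (de , ef , fd) P′ q h =
    exchange (at a (b ∷ c ∷ x ∷ z ∷ y ∷ d ∷ e ∷ f ∷ [])) linked+triangle-exchange
      (ab ∷ bc ∷ ca ∷ xz ∷ zy ∷ xa ∷ xb ∷ xc ∷ ya ∷ yb ∷ de ∷ ef ∷ fd ∷ []) h
      ((λ { (τ , p , t₁ ∷ t₂ ∷ t₃ ∷ u₁ ∷ u₂ ∷ u₃ ∷ v₁ ∷ v₂ ∷ v₃ ∷ []) →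
         perm (insert (a ∷ b ∷ c ∷ x ∷ z ∷ y ∷ []) p q π)
              (tri (t₁ , t₂ , t₃) (tri (u₁ , u₂ , u₃) (tri (v₁ , v₂ , v₃) P′))) }) ∷ [])
  ... | quad {a = d} {e} {f} {g} Q P′ q h with heavyPair z c x y (d ∷ e ∷ f ∷ g ∷ []) h
  ...   | inj₁ h′ = path₃+quad ore (halve-bound bound) (tri (ab , bc , ca) P′) xz zy Q
            (↭-trans (shifts (x ∷ z ∷ y ∷ d ∷ e ∷ f ∷ g ∷ []) (a ∷ b ∷ c ∷ []))
              (↭-trans (++⁺ˡ (a ∷ b ∷ c ∷ x ∷ z ∷ y ∷ []) q) π)) h′
  -- The roles change: a b y becomes the triangle and z x c the spoiled path.
  ...   | inj₂ h′ = path₃+quad ore (halve-bound bound) (tri (ab , Adj-sym yb , ya) P′)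
            (Adj-sym xz) xc Q
            (↭-trans (shifts (z ∷ x ∷ c ∷ d ∷ e ∷ f ∷ g ∷ []) (a ∷ b ∷ y ∷ []))
              (↭-trans (++⁺ˡ (a ∷ b ∷ y ∷ z ∷ x ∷ c ∷ []) q)
                       (regroup (at a (b ∷ c ∷ x ∷ z ∷ y ∷ [])) 6 540123 refl π))) h′
  linkedExchange {r} {s} {L} {a} {b} {c} {x} {z} {y} ore bound P hs π x≁y z≁c inside | light h
    with unique π
  ... | _ ∷ _ ∷ (_ ∷ c≢z ∷ _) ∷ (_ ∷ x≢y ∷ _) ∷ _ = contradiction (inside h)
    (linked-count r s (degree H x) (degree H y) (degree H z) (degree H c)
      (ore x y x≢y x≁y) (ore z c (c≢z ∘ sym) z≁c))

  completeLinked : ∀ {r s L a b c x z y} → Ore (suc (suc r)) s →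
    2 * s ≤ 2 + suc (suc r) → Pack r s L →
    All (Holds (at a (b ∷ c ∷ x ∷ z ∷ y ∷ []))) linked → a ∷ b ∷ c ∷ x ∷ z ∷ y ∷ L ↭ allFin n →
    Pack (suc (suc r)) s (allFin n)
  completeLinked {r} {s} {L} {a} {b} {c} {x} {z} {y} ore bound P
    hs@(ab ∷ bc ∷ ca ∷ xz ∷ zy ∷ xa ∷ xb ∷ xc ∷ ya ∷ yb ∷ []) π
    with adj? x y | adj? z c | adj? y c | adj? z a
  ... | yes xy | _      | _      | _      =
    perm π (tri (ab , bc , ca) (tri (xz , zy , Adj-sym xy) P))
  ... | no _   | yes zc | _      | _      =
    perm (regroup (at a (b ∷ c ∷ x ∷ z ∷ y ∷ [])) 6 540123 refl π)
         (tri (ab , Adj-sym yb , ya) (tri (Adj-sym xz , xc , Adj-sym zc) P))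
  -- With both edges present, x z a and y b c are disjoint triangles. Excluding this lowers the
  -- inside weight from 24 to at most 22.
  ... | no _   | no _   | yes yc | yes za =
    perm (regroup (at a (b ∷ c ∷ x ∷ z ∷ y ∷ [])) 6 215043 refl π)
         (tri (xz , za , Adj-sym xa) (tri (yb , bc , Adj-sym yc) P))
  -- Here the inside weight is even at most 21, since c has weight 2.
  ... | no x≁y | no z≁c | no y≁c | _      =
    linkedExchange ore bound P hs π x≁y z≁c (λ h → m≤n⇒m≤1+n
      (degreeSum-bound (at a (b ∷ c ∷ x ∷ z ∷ y ∷ [])) 6
        ((2 , 1) ∷ (2 , 3) ∷ (1 , 2) ∷ (1 , 0) ∷ [])
        ((2 , 0) ∷ (1 , 3) ∷ (0 , 3) ∷ []) π (x≁y ∷ z≁c ∷ y≁c ∷ []) h))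
  ... | no x≁y | no z≁c | yes _  | no z≁a =
    linkedExchange ore bound P hs π x≁y z≁c (degreeSum-bound
      (at a (b ∷ c ∷ x ∷ z ∷ y ∷ [])) 6 ((2 , 1) ∷ (2 , 3) ∷ (1 , 2) ∷ (1 , 0) ∷ [])
      ((2 , 0) ∷ (1 , 3) ∷ (1 , 5) ∷ []) π (x≁y ∷ z≁c ∷ z≁a ∷ []))

  completePath₃ : ∀ {r s L x z y} → Ore (suc r) s → 2 * s ≤ 2 + suc r → Pack r s L →
    Adj H x z → Adj H z y → x ∷ z ∷ y ∷ L ↭ allFin n → Pack (suc r) s (allFin n)
  completePath₃ {r} {s} {L} {x} {z} {y} ore bound P xz zy π with adj? x y
  ... | yes xy = perm π (tri (xz , zy , Adj-sym xy) P)
  ... | no x≁y with findHeavy (load ((1 , x) ∷ (1 , y) ∷ [])) 4 4 P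
  ...   | tri {a = a} {b} {c} (ab , bc , ca) P′ q h =
            exchange (at x (z ∷ y ∷ a ∷ b ∷ c ∷ [])) path₃+triangle-exchange
              (xz ∷ zy ∷ ab ∷ bc ∷ ca ∷ []) h
              ((λ { (τ , p , h₁ ∷ h₂ ∷ h₃ ∷ h₄ ∷ h₅ ∷ h₆ ∷ h₇ ∷ h₈ ∷ h₉ ∷ h₁₀ ∷ []) →
                 completeLinked ore bound P′
                   (h₁ ∷ h₂ ∷ h₃ ∷ h₄ ∷ h₅ ∷ h₆ ∷ h₇ ∷ h₈ ∷ h₉ ∷ h₁₀ ∷ [])
                   (insert (x ∷ z ∷ y ∷ []) p q π) }) ∷ [])
  ...   | quad Q P′ q h = path₃+quad ore (halve-bound bound) P′ xz zy Q
            (↭-trans (++⁺ˡ (x ∷ z ∷ y ∷ []) q) π) h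
  ...   | light h with unique π
  ...     | (_ ∷ x≢y ∷ _) ∷ _ = contradiction
            (degreeSum-bound (at x (z ∷ y ∷ [])) 3 ((1 , 2) ∷ (1 , 0) ∷ []) ((2 , 0) ∷ [])
              π (x≁y ∷ []) h)
            (path₃-count r s (degree H x) (degree H y) (ore x y x≢y x≁y))

-- Removing the edges of a complete graph one at a time

isPair : ∀ {n} → Fin n → Fin n → Fin n → Fin n → Bool
isPair x y a b = (does (a ≟ᶠ x) ∧ does (b ≟ᶠ y)) ∨ (does (a ≟ᶠ y) ∧ does (b ≟ᶠ x))

-- The test for distinct ends makes adding a pair (x, x) harmless, so all ordered pairs can be
-- added.
addEdge : ∀ {n} → Graph n → Fin n × Fin n → Graph n
addEdge G (x , y) .adj a b = adj G a b ∨ (not (does (a ≟ᶠ b)) ∧ isPair x y a b)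
addEdge G (x , y) .symmetric a b = cong₂ _∨_ (symmetric G a b)
  (cong₂ _∧_ (cong not (does-≡-sym a b)) (trans (∨-comm (does (a ≟ᶠ x) ∧ does (b ≟ᶠ y)) _)
    (cong₂ _∨_ (∧-comm (does (a ≟ᶠ y)) _) (∧-comm (does (a ≟ᶠ x)) _))))
  where
  does-≡-sym : ∀ a b → does (a ≟ᶠ b) ≡ does (b ≟ᶠ a)
  does-≡-sym a b with a ≟ᶠ b | b ≟ᶠ a
  ... | yes _  | yes _  = refl
  ... | no _   | no _   = refl
  ... | yes eq | no ne  = contradiction (sym eq) ne
  ... | no ne  | yes eq = contradiction (sym eq) ne
addEdge G (x , y) .irreflex a with a ≟ᶠ a
... | yes _ = trans (cong (_∨ false) (irreflex G a)) refl
... | no ne = contradiction refl ne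

module _ {n} (G : Graph n) (x y : Fin n) where

  private
    G⁺ = addEdge G (x , y)

  data IsNew : Fin n → Fin n → Set where
    forward  : IsNew x y
    backward : IsNew y x

  addEdge-mono : ∀ {a b} → Adj G a b → Adj G⁺ a b
  addEdge-mono {a} {b} h rewrite h = refl

  addEdge-new : x ≢ y → Adj G⁺ x y
  addEdge-new x≢y with adj G x y | x ≟ᶠ y | x ≟ᶠ x | y ≟ᶠ y
  ... | true  | _      | _     | _     = refl
  ... | false | yes eq | _     | _     = contradiction eq x≢y
  ... | false | no _   | no ne | _     = contradiction refl ne
  ... | false | no _   | yes _ | no ne = contradiction refl ne
  ... | false | no _   | yes _ | yes _ = refl

  addEdge-cases : ∀ {a b} → Adj G⁺ a b → Adj G a b ⊎ IsNew a b
  addEdge-cases {a} {b} h with adj G a b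
  ... | true = inj₁ refl
  ... | false with a ≟ᶠ b | a ≟ᶠ x | b ≟ᶠ y | a ≟ᶠ y | b ≟ᶠ x
  ...   | no _ | yes refl | yes refl | _        | _        = inj₂ forward
  ...   | no _ | _        | _        | yes refl | yes refl = inj₂ backward

  old-edge : ∀ {a b c} → IsNew a b → c ≢ a → c ≢ b → ∀ {d} → Adj G⁺ c d → Adj G c d
  old-edge ab c≢a c≢b h with addEdge-cases h
  ... | inj₁ h′ = h′
  old-edge forward  c≢a c≢b h | inj₂ forward  = contradiction refl c≢a
  old-edge forward  c≢a c≢b h | inj₂ backward = contradiction refl c≢b
  old-edge backward c≢a c≢b h | inj₂ forward  = contradiction refl c≢b
  old-edge backward c≢a c≢b h | inj₂ backward = contradiction refl c≢a

  old-edge-∉ : ∀ {a b c L} → IsNew a b → a ∉ L → b ∉ L → c ∈ L → ∀ {d} → Adj G⁺ c d → Adj G c d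
  old-edge-∉ ab a∉ b∉ c∈ = old-edge ab (λ { refl → a∉ c∈ }) (λ { refl → b∉ c∈ })

  -- A cycle avoiding the ends of the new edge uses only old edges.
  old-pack : ∀ {r s L a b} → IsNew a b → a ∉ L → b ∉ L → Pack G⁺ r s L → Pack G r s L
  old-pack ab a∉ b∉ nil        = nil
  old-pack ab a∉ b∉ (perm p P) = perm p (old-pack ab (a∉ ∘ ∈-resp-↭ p) (b∉ ∘ ∈-resp-↭ p) P)
  old-pack ab a∉ b∉ (tri (cd , de , ec) P) =
    tri (old-edge-∉ ab a∉ b∉ (here refl) cd , old-edge-∉ ab a∉ b∉ (there (here refl)) de ,
         old-edge-∉ ab a∉ b∉ (there (there (here refl))) ec)
        (old-pack ab (a∉ ∘ there ∘ there ∘ there) (b∉ ∘ there ∘ there ∘ there) P)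
  old-pack ab a∉ b∉ (quad (cd , de , ef , fc) P) =
    quad (old-edge-∉ ab a∉ b∉ (here refl) cd , old-edge-∉ ab a∉ b∉ (there (here refl)) de ,
          old-edge-∉ ab a∉ b∉ (there (there (here refl))) ef ,
          old-edge-∉ ab a∉ b∉ (there (there (there (here refl)))) fc)
         (old-pack ab (a∉ ∘ there ∘ there ∘ there ∘ there) (b∉ ∘ there ∘ there ∘ there ∘ there) P)

  -- A broken cycle is recorded as the path left after deleting its new edge.
  data NearPack : ℕ → ℕ → List (Fin n) → Set where
    whole : ∀ {r s L} → Pack G r s L → NearPack r s L
    broken₃ : ∀ {r s L L′ a z b} → Adj G a z → Adj G z b → Pack G r s L′ → a ∷ z ∷ b ∷ L′ ↭ L →
            NearPack (suc r) s L
    broken₄ : ∀ {r s L L′ a u v b} → Adj G a u → Adj G u v → Adj G v b → Pack G r s L′ →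
            a ∷ u ∷ v ∷ b ∷ L′ ↭ L → NearPack r (suc s) L

  break-triangle : ∀ {r s L L′ a b c} → IsNew a b → Adj G⁺ b c → Adj G⁺ c a → Pack G⁺ r s L′ →
    a ∷ b ∷ c ∷ L′ ↭ L → Unique L → NearPack (suc r) s L
  break-triangle {a = a} {b} {c} ab bc ca P p L! with Unique-resp-↭ (↭-sym p) L!
  ... | (a≢b ∷ a≢c ∷ a∉) ∷ (b≢c ∷ b∉) ∷ _ =
    broken₃ (Adj-sym G (old ca)) (old (Adj-sym G⁺ bc))
      (old-pack ab (All.All¬⇒¬Any a∉) (All.All¬⇒¬Any b∉) P)
      (↭-trans (prep a (swap c b refl)) p)
    where
    old : ∀ {d} → Adj G⁺ c d → Adj G c d
    old = old-edge ab (a≢c ∘ sym) (b≢c ∘ sym)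

  break-quad : ∀ {r s L L′ a b c d} → IsNew a b → Adj G⁺ b c → Adj G⁺ c d → Adj G⁺ d a →
    Pack G⁺ r s L′ → a ∷ b ∷ c ∷ d ∷ L′ ↭ L → Unique L → NearPack r (suc s) L
  break-quad {a = a} {b} {c} {d} ab bc cd da P p L! with Unique-resp-↭ (↭-sym p) L!
  ... | (a≢b ∷ a≢c ∷ a≢d ∷ a∉) ∷ (b≢c ∷ b≢d ∷ b∉) ∷ _ =
    -- The remaining path is b c d a.
    broken₄ (Adj-sym G (oldC (Adj-sym G⁺ bc))) (oldC cd) (oldD da)
      (old-pack ab (All.All¬⇒¬Any a∉) (All.All¬⇒¬Any b∉) P)
      (↭-trans (shift a (b ∷ c ∷ d ∷ []) _) p)
    where
    oldC : ∀ {e} → Adj G⁺ c e → Adj G c e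
    oldC = old-edge ab (a≢c ∘ sym) (b≢c ∘ sym)
    oldD : ∀ {e} → Adj G⁺ d e → Adj G d e
    oldD = old-edge ab (a≢d ∘ sym) (b≢d ∘ sym)

  -- The cycles are disjoint, so once one of them uses the new edge, all the others consist of old
  -- edges.
  removeEdge : ∀ {r s L} → Pack G⁺ r s L → Unique L → NearPack r s L
  removeEdge nil L! = whole nil
  removeEdge (perm p P) L! with removeEdge P (Unique-resp-↭ (↭-sym p) L!)
  ... | whole P′           = whole (perm p P′)
  ... | broken₃ az zb P′ q   = broken₃ az zb P′ (↭-trans q p)
  ... | broken₄ au uv vb P′ q = broken₄ au uv vb P′ (↭-trans q p)
  removeEdge (tri {L = L} {a} {b} {c} (ab , bc , ca) P) L!@(_ ∷ _ ∷ _ ∷ L!′)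
    with addEdge-cases ab | addEdge-cases bc | addEdge-cases ca
  ... | inj₂ ab′ | _ | _ = break-triangle ab′ bc ca P ↭-refl L!
  -- The cycle is rotated so that the new edge comes first.
  ... | _ | inj₂ bc′ | _ = break-triangle bc′ ca ab P (shift a (b ∷ c ∷ []) L) L!
  ... | _ | _ | inj₂ ca′ = break-triangle ca′ ab bc P (↭-sym (shift c (a ∷ b ∷ []) L)) L!
  ... | inj₁ ab′ | inj₁ bc′ | inj₁ ca′ with removeEdge P L!′
  ...   | whole P′            = whole (tri (ab′ , bc′ , ca′) P′)
  ...   | broken₃ az zb P′ q    = broken₃ az zb (tri (ab′ , bc′ , ca′) P′)
            (slide (_ ∷ _ ∷ _ ∷ []) (a ∷ b ∷ c ∷ []) q)
  ...   | broken₄ au uv vb P′ q = broken₄ au uv vb (tri (ab′ , bc′ , ca′) P′)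
            (slide (_ ∷ _ ∷ _ ∷ _ ∷ []) (a ∷ b ∷ c ∷ []) q)
  removeEdge (quad {L = L} {a} {b} {c} {d} (ab , bc , cd , da) P) L!@(_ ∷ _ ∷ _ ∷ _ ∷ L!′)
    with addEdge-cases ab | addEdge-cases bc | addEdge-cases cd | addEdge-cases da
  ... | inj₂ ab′ | _ | _ | _ = break-quad ab′ bc cd da P ↭-refl L!
  ... | _ | inj₂ bc′ | _ | _ = break-quad bc′ cd da ab P (shift a (b ∷ c ∷ d ∷ []) L) L!
  ... | _ | _ | inj₂ cd′ | _ = break-quad cd′ da ab bc P (shifts (c ∷ d ∷ []) (a ∷ b ∷ [])) L!
  ... | _ | _ | _ | inj₂ da′ = break-quad da′ ab bc cd P (↭-sym (shift d (a ∷ b ∷ c ∷ []) L)) L!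
  ... | inj₁ ab′ | inj₁ bc′ | inj₁ cd′ | inj₁ da′ with removeEdge P L!′
  ...   | whole P′            = whole (quad (ab′ , bc′ , cd′ , da′) P′)
  ...   | broken₃ az zb P′ q    = broken₃ az zb (quad (ab′ , bc′ , cd′ , da′) P′)
            (slide (_ ∷ _ ∷ _ ∷ []) (a ∷ b ∷ c ∷ d ∷ []) q)
  ...   | broken₄ au uv vb P′ q = broken₄ au uv vb (quad (ab′ , bc′ , cd′ , da′) P′)
            (slide (_ ∷ _ ∷ _ ∷ _ ∷ []) (a ∷ b ∷ c ∷ d ∷ []) q)

  degree-mono : ∀ v → degree G v ≤ degree G⁺ v
  degree-mono v = subst₂ _≤_ (sym (degree≡degreeIn G v)) (sym (degree≡degreeIn G⁺ v))
    (go (allFin n))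
    where
    adj#-mono : ∀ w → adj# G v w ≤ adj# G⁺ v w
    adj#-mono w with adj G v w
    ... | true  = ≤-refl
    ... | false = z≤n
    go : ∀ vs → degreeIn G vs v ≤ degreeIn G⁺ vs v
    go []       = z≤n
    go (w ∷ vs) = +-mono-≤ (adj#-mono w) (go vs)

  σ₂-mono : ∀ k → σ₂≥ G k → σ₂≥ G⁺ k
  σ₂-mono k σ a b a≢b a≁b = ≤-trans (σ a b a≢b (a≁b ∘ addEdge-mono))
    (+-mono-≤ (degree-mono a) (degree-mono b))

  restore : ∀ {r s} → Ore G r s → 2 * s ≤ 2 + r → Pack G⁺ r s (allFin n) → Pack G r s (allFin n)
  restore ore bound P with removeEdge P (allFin⁺ n)
  ... | whole P′            = P′
  ... | broken₃ az zb P′ π    = completePath₃ G ore bound P′ az zb π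
  ... | broken₄ au uv vb P′ π = completePath₄ G ore (halve-bound bound) P′ (au ∷ uv ∷ vb ∷ []) π

addEdges : ∀ {n} → Graph n → List (Fin n × Fin n) → Graph n
addEdges G []       = G
addEdges G (e ∷ es) = addEdges (addEdge G e) es

-- Edges are deleted in the reverse order of addition. Every intermediate graph contains `G` and
-- inherits its Ore inequalities.
restoreAll : ∀ {n} (G : Graph n) es {r s} → Ore G r s → 2 * s ≤ 2 + r →
  Pack (addEdges G es) r s (allFin n) → Pack G r s (allFin n)
restoreAll G []             ore bound P = P
restoreAll G ((x , y) ∷ es) ore bound P =
  restore G x y ore bound (restoreAll (addEdge G (x , y)) es (σ₂-mono G x y _ ore) bound P)

addEdges-mono : ∀ {n} (G : Graph n) es {a b} → Adj G a b → Adj (addEdges G es) a b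
addEdges-mono G []             h = h
addEdges-mono G ((x , y) ∷ es) h = addEdges-mono (addEdge G (x , y)) es (addEdge-mono G x y h)

addEdges-new : ∀ {n} (G : Graph n) es {a b} → a ≢ b → (a , b) ∈ es → Adj (addEdges G es) a b
addEdges-new G ((x , y) ∷ es) a≢b (here refl) =
  addEdges-mono (addEdge G (x , y)) es (addEdge-new G x y a≢b)
addEdges-new G (e ∷ es)       a≢b (there h)   = addEdges-new (addEdge G e) es a≢b h

complete-pack : ∀ {n} (G : Graph n) → (∀ {a b} → a ≢ b → Adj G a b) →
  ∀ r s L → length L ≡ 3 * r + 4 * s → Unique L → Pack G r s L
complete-pack G edge zero zero [] eq L! = nil
complete-pack G edge (suc r) s L eq L! = tris L (trans eq (rearranged r s)) L!
  where
  rearranged : ∀ r s → 3 * suc r + 4 * s ≡ 3 + (3 * r + 4 * s)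
  rearranged = solve-∀
  -- With the length in successor form, matching on three vertices leaves no shorter list to
  -- consider.
  tris : ∀ L → length L ≡ 3 + (3 * r + 4 * s) → Unique L → Pack G (suc r) s L
  tris (a ∷ b ∷ c ∷ L) eq ((a≢b ∷ a≢c ∷ _) ∷ (b≢c ∷ _) ∷ _ ∷ L!) =
    tri (edge a≢b , edge b≢c , edge (a≢c ∘ sym))
        (complete-pack G edge r s L (suc-injective (suc-injective (suc-injective eq))) L!)
complete-pack G edge zero (suc s) L eq L! = quads L (trans eq (*-suc 4 s)) L!
  where
  quads : ∀ L → length L ≡ 4 + 4 * s → Unique L → Pack G zero (suc s) L
  quads (a ∷ b ∷ c ∷ d ∷ L) eq ((a≢b ∷ _ ∷ a≢d ∷ _) ∷ (b≢c ∷ _) ∷ (c≢d ∷ _) ∷ _ ∷ L!) =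
    quad (edge a≢b , edge b≢c , edge c≢d , edge (a≢d ∘ sym))
         (complete-pack G edge zero s L
           (suc-injective (suc-injective (suc-injective (suc-injective eq)))) L!)

-- From packings to indexed families of disjoint cycles.

vertexAt : ∀ {A : Set} {r s} → (Fin r → Fin 3 → A) → (Fin s → Fin 4 → A) →
  (Fin r × Fin 3) ⊎ (Fin s × Fin 4) → A
vertexAt T Q (inj₁ (i , a)) = T i a
vertexAt T Q (inj₂ (j , b)) = Q j b

-- The field `within` strengthens the induction: it shows that a newly added cycle is disjoint from
-- the earlier ones.
record Cycles {n} (G : Graph n) (r s : ℕ) (L : List (Fin n)) : Set where
  field
    T         : Fin r → Fin 3 → Fin n
    Q         : Fin s → Fin 4 → Fin n
    triangles : ∀ i → Triangle G (T i 0F) (T i 1F) (T i 2F)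
    quads     : ∀ j → Quad G (Q j 0F) (Q j 1F) (Q j 2F) (Q j 3F)
    within    : ∀ v → vertexAt T Q v ∈ L
    injective : ∀ v w → vertexAt T Q v ≡ vertexAt T Q w → v ≡ w

disjoint-injective : ∀ {A I V : Set} {f : A → V} {g : I → V} {L} →
  (∀ a b → f a ≡ f b → a ≡ b) → (∀ i j → g i ≡ g j → i ≡ j) → (∀ a → f a ∉ L) → (∀ i → g i ∈ L) →
  ∀ v w → [ f , g ]′ v ≡ [ f , g ]′ w → v ≡ w
disjoint-injective f-inj g-inj f∉ g∈ (inj₁ a) (inj₁ b) eq = cong inj₁ (f-inj a b eq)
disjoint-injective f-inj g-inj f∉ g∈ (inj₂ i) (inj₂ j) eq = cong inj₂ (g-inj i j eq)
disjoint-injective f-inj g-inj f∉ g∈ (inj₁ a) (inj₂ j) eq =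
  contradiction (subst (_∈ _) (sym eq) (g∈ j)) (f∉ a)
disjoint-injective f-inj g-inj f∉ g∈ (inj₂ i) (inj₁ b) eq =
  contradiction (subst (_∈ _) eq (g∈ i)) (f∉ b)

consᶠ : ∀ {A : Set} {k m} → Vec.Vec A k → (Fin m → Fin k → A) → Fin (suc m) → Fin k → A
consᶠ xs f zero    = Vec.lookup xs
consᶠ xs f (suc i) = f i

cycles : ∀ {n} {G : Graph n} {r s L} → Pack G r s L → Unique L → Cycles G r s L
cycles nil L! = record
  { T = λ () ; Q = λ () ; triangles = λ () ; quads = λ ()
  ; within = λ { (inj₁ ()) ; (inj₂ ()) } ; injective = λ { (inj₁ ()) ; (inj₂ ()) } }
cycles (perm p P) L! = record
  { T = T ; Q = Q ; triangles = triangles ; quads = quads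
  ; within = ∈-resp-↭ p ∘ within ; injective = injective }
  where open Cycles (cycles P (Unique-resp-↭ (↭-sym p) L!))
cycles {n} {G} {suc r} {s} (tri {L = L} {a} {b} {c} t P)
  ((a≢b ∷ a≢c ∷ a∉) ∷ (b≢c ∷ b∉) ∷ c∉ ∷ L!) = record
  { T = T′ ; Q = Q
  ; triangles = λ { zero → t ; (suc i) → triangles i }
  ; quads = quads
  ; within = λ
      { (inj₁ (zero , 0F)) → here refl
      ; (inj₁ (zero , 1F)) → there (here refl)
      ; (inj₁ (zero , 2F)) → there (there (here refl))
      ; (inj₁ (suc i , e)) → there (there (there (within (inj₁ (i , e)))))
      ; (inj₂ j)           → there (there (there (within (inj₂ j)))) }
  ; injective = λ v w eq → trans (sym (join-split v)) (trans (cong join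
      (disjoint-injective (lookup-injective distinct) injective outside within
        (split v) (split w) (trans (sym (vertex-split v)) (trans eq (vertex-split w)))))
      (join-split w)) }
  where
  open Cycles (cycles P L!)
  abc = a Vec.∷ b Vec.∷ c Vec.∷ Vec.[]
  T′ = consᶠ abc T
  distinct : Vec.Unique abc
  distinct = (a≢b ∷ a≢c ∷ []) ∷ (b≢c ∷ []) ∷ [] ∷ []
  outside : ∀ i → Vec.lookup abc i ∉ L
  outside 0F = All.All¬⇒¬Any a∉
  outside 1F = All.All¬⇒¬Any b∉
  outside 2F = All.All¬⇒¬Any c∉
  -- Positions on the new triangle are separated from the others, so that injectivity reduces to two
  -- injective maps with disjoint images.
  split : (Fin (suc r) × Fin 3) ⊎ (Fin s × Fin 4) → Fin 3 ⊎ ((Fin r × Fin 3) ⊎ (Fin s × Fin 4))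
  split (inj₁ (zero , e))  = inj₁ e
  split (inj₁ (suc i , e)) = inj₂ (inj₁ (i , e))
  split (inj₂ j)           = inj₂ (inj₂ j)
  join : Fin 3 ⊎ ((Fin r × Fin 3) ⊎ (Fin s × Fin 4)) → (Fin (suc r) × Fin 3) ⊎ (Fin s × Fin 4)
  join (inj₁ e)              = inj₁ (zero , e)
  join (inj₂ (inj₁ (i , e))) = inj₁ (suc i , e)
  join (inj₂ (inj₂ j))       = inj₂ j
  join-split : ∀ v → join (split v) ≡ v
  join-split (inj₁ (zero , e))  = refl
  join-split (inj₁ (suc i , e)) = refl
  join-split (inj₂ j)           = refl
  vertex-split : ∀ v → vertexAt T′ Q v ≡ [ Vec.lookup abc , vertexAt T Q ]′ (split v)
  vertex-split (inj₁ (zero , e))  = refl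
  vertex-split (inj₁ (suc i , e)) = refl
  vertex-split (inj₂ j)           = refl
cycles {n} {G} {r} {suc s} (quad {L = L} {a} {b} {c} {d} t P)
  ((a≢b ∷ a≢c ∷ a≢d ∷ a∉) ∷ (b≢c ∷ b≢d ∷ b∉) ∷ (c≢d ∷ c∉) ∷ d∉ ∷ L!) = record
  { T = T ; Q = Q′
  ; triangles = triangles
  ; quads = λ { zero → t ; (suc i) → quads i }
  ; within = λ
      { (inj₂ (zero , 0F)) → here refl
      ; (inj₂ (zero , 1F)) → there (here refl)
      ; (inj₂ (zero , 2F)) → there (there (here refl))
      ; (inj₂ (zero , 3F)) → there (there (there (here refl)))
      ; (inj₂ (suc j , e)) → there (there (there (there (within (inj₂ (j , e))))))
      ; (inj₁ i)           → there (there (there (there (within (inj₁ i))))) }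
  ; injective = λ v w eq → trans (sym (join-split v)) (trans (cong join
      (disjoint-injective (lookup-injective distinct) injective outside within
        (split v) (split w) (trans (sym (vertex-split v)) (trans eq (vertex-split w)))))
      (join-split w)) }
  where
  open Cycles (cycles P L!)
  abcd = a Vec.∷ b Vec.∷ c Vec.∷ d Vec.∷ Vec.[]
  Q′ = consᶠ abcd Q
  distinct : Vec.Unique abcd
  distinct = (a≢b ∷ a≢c ∷ a≢d ∷ []) ∷ (b≢c ∷ b≢d ∷ []) ∷ (c≢d ∷ []) ∷ [] ∷ []
  outside : ∀ i → Vec.lookup abcd i ∉ L
  outside 0F = All.All¬⇒¬Any a∉
  outside 1F = All.All¬⇒¬Any b∉
  outside 2F = All.All¬⇒¬Any c∉
  outside 3F = All.All¬⇒¬Any d∉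
  split : (Fin r × Fin 3) ⊎ (Fin (suc s) × Fin 4) → Fin 4 ⊎ ((Fin r × Fin 3) ⊎ (Fin s × Fin 4))
  split (inj₂ (zero , e))  = inj₁ e
  split (inj₂ (suc j , e)) = inj₂ (inj₂ (j , e))
  split (inj₁ i)           = inj₂ (inj₁ i)
  join : Fin 4 ⊎ ((Fin r × Fin 3) ⊎ (Fin s × Fin 4)) → (Fin r × Fin 3) ⊎ (Fin (suc s) × Fin 4)
  join (inj₁ e)              = inj₂ (zero , e)
  join (inj₂ (inj₂ (j , e))) = inj₂ (suc j , e)
  join (inj₂ (inj₁ i))       = inj₁ i
  join-split : ∀ v → join (split v) ≡ v
  join-split (inj₂ (zero , e))  = refl
  join-split (inj₂ (suc j , e)) = refl
  join-split (inj₁ i)           = refl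
  vertex-split : ∀ v → vertexAt T Q′ v ≡ [ Vec.lookup abcd , vertexAt T Q ]′ (split v)
  vertex-split (inj₂ (zero , e))  = refl
  vertex-split (inj₂ (suc j , e)) = refl
  vertex-split (inj₁ i)           = refl

theorem2 : (r s : ℕ) → 1 ≤ r → 1 ≤ s → 2 * s ∸ 2 ≤ r
    → (G : Graph (3 * r + 4 * s))
    → σ₂≥ G (3 * r + 4 * s + r)
    → HasDisjointTrianglesQuads G r s
theorem2 r s 1≤r 1≤s 2s-2≤r G σ =
  T , Q ,
  -- The vertex maps of the statement and of `Cycles` agree by computation once the summand is
  -- known.
  (λ { {inj₁ v} {inj₁ w} eq → injective (inj₁ v) (inj₁ w) eq
     ; {inj₁ v} {inj₂ w} eq → injective (inj₁ v) (inj₂ w) eq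
     ; {inj₂ v} {inj₁ w} eq → injective (inj₂ v) (inj₁ w) eq
     ; {inj₂ v} {inj₂ w} eq → injective (inj₂ v) (inj₂ w) eq }) ,
  triangles , quads
  where
  n = 3 * r + 4 * s
  -- Adding all ordered pairs makes the graph complete.
  es = cartesianProduct (allFin n) (allFin n)

  4k : ∀ r s → 3 * r + 4 * s + r ≡ 4 * (r + s)
  4k = solve-∀

  complete : Pack (addEdges G es) r s (allFin n)
  complete = complete-pack (addEdges G es)
    (λ {a} {b} a≢b → addEdges-new G es a≢b (∈-cartesianProduct⁺ (∈-allFin a) (∈-allFin b)))
    r s (allFin n) (length-tabulate id) (allFin⁺ n)

  -- The truncated difference satisfies 2s ≤ 2 + (2s ∸ 2), which gives 2s ≤ 2 + r.
  open Cycles (cycles (restoreAll G es (subst (σ₂≥ G) (4k r s) σ)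
    (≤-trans (m≤n+m∸n (2 * s) 2) (+-monoʳ-≤ 2 2s-2≤r)) complete) (allFin⁺ n))
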